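{- Let $\mathcal F$ be a sheaf on a digraph $G$. For all subspaces $U_1,U_2\subset\mathcal F(V)$, $${\rm excess}(\mathcal F,U_1)+{\rm excess}(\mathcal F,U_2)\le{\rm excess}(\mathcal F,U_1\cap U_2)+{\rm excess}(\mathcal F,U_1+U_2).$$ Consequently the set of subspaces $U\subset\mathcal F(V)$ with ${\rm excess}(\mathcal F,U)={\rm m.e.}(\mathcal F)$ is closed under intersection and sum (so has a unique maximal and a unique minimal element), and for any two such maximizers $U_1,U_2$ one has $\Gamma_{\rm ht}(U_1+U_2)=\Gamma_{\rm ht}(U_1)+\Gamma_{\rm ht}(U_2)$.
   Context: A digraph has finite vertex and edge sets with tail/head maps. A sheaf $\mathcal F$ on $G$: finite-dimensional $\mathbb F$-vector spaces $\mathcal F(P)$, $P\in V_G\sqcup E_G$, with linear maps $\mathcal F(t,e)\colon\mathcal F(e)\to\mathcal F(t_Ge)$, $\mathcal F(h,e)\colon\mathcal F(e)\to\mathcal F(h_Ge)$; $\mathcal F(V)=\bigoplus_v\mathcal F(v)$, $\mathcal F(E)=\bigoplus_e\mathcal F(e)$; $d_h,d_t\colon\mathcal F(E)\to\mathcal F(V)$ send the summand $\mathcal F(e)$ into $\mathcal F(h_Ge)$ resp. $\mathcal F(t_Ge)$ via the restriction maps. For $U\subset\mathcal F(V)$, $\Gamma_{\rm ht}(U)=\bigoplus_e\{w\in\mathcal F(e):d_hw\in U,\ d_tw\in U\}\subset\mathcal F(E)$, ${\rm excess}(\mathcal F,U)=\dim\Gamma_{\rm ht}(U)-\dim U$, ${\rm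 m.e.}(\mathcal F)=\max_U{\rm excess}(\mathcal F,U)$. -}

module Defs where

open import Algebra.Bundles using (CommutativeRing; CommutativeMonoid)
open import Algebra.Module.Bundles using (LeftModule)
open import Algebra.Module.Morphism.Structures using (module LeftModuleMorphisms)
import Algebra.Module.Morphism.Construct.Composition as Composition
import Algebra.Properties.CommutativeMonoid.Sum as Sum
import Algebra.Properties.CommutativeSemigroup as CommutativeSemigroupProperties
import Algebra.Properties.Group as GroupProperties
open import Axiom.ExcludedMiddle using (ExcludedMiddle)
open import Data.Fin.Base using (Fin; zero; suc)
open import Data.Fin.Properties using (_≟_)
open import Data.Integer.Base using (ℤ; 0ℤ; _⊖_; _≤_)
open import Data.Nat.Base using (ℕ; zero; suc)
open import Data.Product.Base using (∃; ∃₂; _×_; _,_)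
open import Data.Unit.Polymorphic.Base using (⊤; tt)
open import Data.Vec.Functional using (Vector)
open import Function.Base using (_∘_)
open import Level using (Level; 0ℓ; Lift; lift; lower) renaming (suc to lsuc)
open import Relation.Binary.Definitions using (_Respects_)
open import Relation.Binary.PropositionalEquality.Core as ≡ using (_≡_)
open import Relation.Nullary.Decidable using (Dec; yes; no; map′)
open import Relation.Unary using (Pred; _⊆_; _≐_)

private
  variable
    ℓ : Level

record Field ℓ : Set (lsuc ℓ) where
  field
    commutativeRing : CommutativeRing ℓ ℓ

  open CommutativeRing commutativeRing public

  field
    1≉0     : 1# ≉ 0#
    inverse : ∀ x → x ≉ 0# → ∃ λ y → x * y ≈ 1#

-- Without eta, so that K can be inferred from V : VectorSpace K and the
-- summands M from ⨁ M below.
record VectorSpace (K : Field ℓ) : Set (lsuc ℓ) where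
  no-eta-equality
  field
    leftModule : LeftModule (Field.ring K) ℓ ℓ

  open LeftModule leftModule public

module _ {K : Field ℓ} where

  open Field K using () renaming (Carrier to 𝕂; _≈_ to _≈ᴷ_; 0# to 0ᴷ)

  ∣_∣ : VectorSpace K → Set ℓ
  ∣ V ∣ = VectorSpace.Carrierᴹ V

  record LinearMap (V W : VectorSpace K) : Set ℓ where
    private
      module V = VectorSpace V
      module W = VectorSpace W
    open LeftModuleMorphisms V.rawLeftModule W.rawLeftModule
    field
      ⟦_⟧                      : ∣ V ∣ → ∣ W ∣
      isLeftModuleHomomorphism : IsLeftModuleHomomorphism ⟦_⟧
    open IsLeftModuleHomomorphism isLeftModuleHomomorphism public

  open LinearMap public using (⟦_⟧)

  module _ {V W : VectorSpace K} where
    private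
      module V = VectorSpace V
      module W = VectorSpace W

    linearMap : (f : ∣ V ∣ → ∣ W ∣) →
                (∀ {x y} → x V.≈ᴹ y → f x W.≈ᴹ f y) →
                (∀ x y → f (x V.+ᴹ y) W.≈ᴹ f x W.+ᴹ f y) →
                (∀ a x → f (a V.*ₗ x) W.≈ᴹ a W.*ₗ f x) →
                LinearMap V W
    linearMap f f-cong f-+ f-* = record
      { ⟦_⟧ = f
      ; isLeftModuleHomomorphism = record
        { +ᴹ-isGroupHomomorphism = record
          { isMonoidHomomorphism = record
            { isMagmaHomomorphism = record
              { isRelHomomorphism = record { cong = f-cong }
              ; homo = f-+
              }
            ; ε-homo = f-0
            }
          ; ⁻¹-homo = λ x → inverseˡ-unique (f (V.-ᴹ x)) (f x)
              (W.≈ᴹ-trans (W.≈ᴹ-sym (f-+ (V.-ᴹ x) x))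
                (W.≈ᴹ-trans (f-cong (V.-ᴹ‿inverseˡ x)) f-0))
          }
        ; *ₗ-homo = f-*
        }
      }
      where
      open GroupProperties W.+ᴹ-group using (inverseˡ-unique)
      f-0 : f V.0ᴹ W.≈ᴹ W.0ᴹ
      f-0 = W.≈ᴹ-trans (f-cong (V.≈ᴹ-sym (V.*ₗ-zeroˡ V.0ᴹ)))
              (W.≈ᴹ-trans (f-* 0ᴷ V.0ᴹ) (W.*ₗ-zeroˡ (f V.0ᴹ)))

  infixr 9 _∘ₗ_

  _∘ₗ_ : {U V W : VectorSpace K} → LinearMap V W → LinearMap U V → LinearMap U W
  _∘ₗ_ {W = W} g f = record
    { ⟦_⟧ = ⟦ g ⟧ ∘ ⟦ f ⟧
    ; isLeftModuleHomomorphism = Composition.isLeftModuleHomomorphism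
        (VectorSpace.≈ᴹ-trans W)
        (LinearMap.isLeftModuleHomomorphism f)
        (LinearMap.isLeftModuleHomomorphism g)
    }

  ⨁ : ∀ {n} → (Fin n → VectorSpace K) → VectorSpace K
  VectorSpace.leftModule (⨁ {n} M) = record
    { Carrierᴹ = ∀ i → ∣ M i ∣
    ; _≈ᴹ_     = λ x y → ∀ i → M._≈ᴹ_ i (x i) (y i)
    ; _+ᴹ_     = λ x y i → M._+ᴹ_ i (x i) (y i)
    ; _*ₗ_     = λ a x i → M._*ₗ_ i a (x i)
    ; 0ᴹ       = λ i → M.0ᴹ i
    ; -ᴹ_      = λ x i → M.-ᴹ_ i (x i)
    ; isLeftModule = record
      { isLeftSemimodule = record
        { +ᴹ-isCommutativeMonoid = record
          { isMonoid = record
            { isSemigroup = record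
              { isMagma = record
                { isEquivalence = record
                  { refl  = λ i → M.≈ᴹ-refl i
                  ; sym   = λ p i → M.≈ᴹ-sym i (p i)
                  ; trans = λ p q i → M.≈ᴹ-trans i (p i) (q i)
                  }
                ; ∙-cong = λ p q i → M.+ᴹ-cong i (p i) (q i)
                }
              ; assoc = λ x y z i → M.+ᴹ-assoc i (x i) (y i) (z i)
              }
            ; identity = (λ x i → M.+ᴹ-identityˡ i (x i))
                       , (λ x i → M.+ᴹ-identityʳ i (x i))
            }
          ; comm = λ x y i → M.+ᴹ-comm i (x i) (y i)
          }
        ; isPreleftSemimodule = record
          { *ₗ-cong      = λ p q i → M.*ₗ-cong i p (q i)
          ; *ₗ-zeroˡ     = λ x i → M.*ₗ-zeroˡ i (x i)
          ; *ₗ-distribʳ  = λ x a b i → M.*ₗ-distribʳ i (x i) a b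
          ; *ₗ-identityˡ = λ x i → M.*ₗ-identityˡ i (x i)
          ; *ₗ-assoc     = λ a b x i → M.*ₗ-assoc i a b (x i)
          ; *ₗ-zeroʳ     = λ a i → M.*ₗ-zeroʳ i a
          ; *ₗ-distribˡ  = λ a x y i → M.*ₗ-distribˡ i a (x i) (y i)
          }
        }
      ; -ᴹ‿cong    = λ p i → M.-ᴹ‿cong i (p i)
      ; -ᴹ‿inverse = (λ x i → M.-ᴹ‿inverseˡ i (x i))
                   , (λ x i → M.-ᴹ‿inverseʳ i (x i))
      }
    }
    where module M (i : Fin n) = VectorSpace (M i)

  ι : ∀ {n} {M : Fin n → VectorSpace K} (i : Fin n) → LinearMap (M i) (⨁ M)
  ι {n} {M} i = linearMap {W = ⨁ M} f
    (λ p j → f-cong p j) (λ x y j → f-+ x y j) (λ a x j → f-* a x j)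
    where
    module M (j : Fin n) = VectorSpace (M j)

    f : ∣ M i ∣ → ∀ j → ∣ M j ∣
    f x j with i ≟ j
    ... | yes ≡.refl = x
    ... | no  _      = M.0ᴹ j

    f-cong : ∀ {x y} → M._≈ᴹ_ i x y → ∀ j → M._≈ᴹ_ j (f x j) (f y j)
    f-cong p j with i ≟ j
    ... | yes ≡.refl = p
    ... | no  _      = M.≈ᴹ-refl j

    f-+ : ∀ x y j → M._≈ᴹ_ j (f (M._+ᴹ_ i x y) j) (M._+ᴹ_ j (f x j) (f y j))
    f-+ x y j with i ≟ j
    ... | yes ≡.refl = M.≈ᴹ-refl i
    ... | no  _      = M.≈ᴹ-sym j (M.+ᴹ-identityˡ j (M.0ᴹ j))

    f-* : ∀ a x j → M._≈ᴹ_ j (f (M._*ₗ_ i a x) j) (M._*ₗ_ j a (f x j))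
    f-* a x j with i ≟ j
    ... | yes ≡.refl = M.≈ᴹ-refl i
    ... | no  _      = M.≈ᴹ-sym j (M.*ₗ-zeroʳ j a)

  ∑ : (V : VectorSpace K) → ∀ {n} → Vector ∣ V ∣ n → ∣ V ∣
  ∑ V = Sum.sum (VectorSpace.+ᴹ-commutativeMonoid V)

  -- The linear map out of a direct sum with prescribed restrictions to
  -- the summands.
  copair : ∀ {n} {M : Fin n → VectorSpace K} {W : VectorSpace K} →
           (∀ i → LinearMap (M i) W) → LinearMap (⨁ M) W
  copair {n} {M} {W} f = linearMap {V = ⨁ M}
    (λ x → ∑ W (λ i → ⟦ f i ⟧ (x i)))
    (λ p → S.sum-cong-≋ (λ i → f.⟦⟧-cong i (p i)))
    (λ x y → W.≈ᴹ-trans (S.sum-cong-≋ (λ i → f.+ᴹ-homo i (x i) (y i)))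
                        (S.∑-distrib-+ (λ i → ⟦ f i ⟧ (x i)) (λ i → ⟦ f i ⟧ (y i))))
    (λ a x → W.≈ᴹ-trans (S.sum-cong-≋ (λ i → f.*ₗ-homo i a (x i)))
                        (∑-* a (λ i → ⟦ f i ⟧ (x i))))
    where
    module W = VectorSpace W
    module S = Sum W.+ᴹ-commutativeMonoid
    module f (i : Fin n) = LinearMap (f i)

    ∑-* : ∀ a {m} (x : Vector ∣ W ∣ m) →
          ∑ W (λ i → a W.*ₗ x i) W.≈ᴹ a W.*ₗ ∑ W x
    ∑-* a {zero}  x = W.≈ᴹ-sym (W.*ₗ-zeroʳ a)
    ∑-* a {suc m} x = W.≈ᴹ-trans (W.+ᴹ-cong W.≈ᴹ-refl (∑-* a (x ∘ suc)))
                                 (W.≈ᴹ-sym (W.*ₗ-distribˡ a _ _))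

  record Subspace (V : VectorSpace K) : Set (lsuc ℓ) where
    open VectorSpace V
    field
      ⟪_⟫       : Pred ∣ V ∣ ℓ
      respects  : ⟪_⟫ Respects _≈ᴹ_
      0-closed  : ⟪_⟫ 0ᴹ
      +-closed  : ∀ {x y} → ⟪_⟫ x → ⟪_⟫ y → ⟪_⟫ (x +ᴹ y)
      *ₗ-closed : ∀ a {x} → ⟪_⟫ x → ⟪_⟫ (a *ₗ x)

  open Subspace public using (⟪_⟫)

  module _ {V : VectorSpace K} where
    open VectorSpace V

    infix  4 _⊑_ _≋_
    infixl 6 _⊕_
    infixl 7 _⊓_

    _⊑_ : Subspace V → Subspace V → Set ℓ
    U₁ ⊑ U₂ = ⟪ U₁ ⟫ ⊆ ⟪ U₂ ⟫

    _≋_ : Subspace V → Subspace V → Set ℓ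
    U₁ ≋ U₂ = ⟪ U₁ ⟫ ≐ ⟪ U₂ ⟫

    _⊓_ : Subspace V → Subspace V → Subspace V
    U₁ ⊓ U₂ = record
      { ⟪_⟫       = λ x → ⟪ U₁ ⟫ x × ⟪ U₂ ⟫ x
      ; respects  = λ p (u₁ , u₂) → U₁.respects p u₁ , U₂.respects p u₂
      ; 0-closed  = U₁.0-closed , U₂.0-closed
      ; +-closed  = λ (u₁ , u₂) (v₁ , v₂) → U₁.+-closed u₁ v₁ , U₂.+-closed u₂ v₂
      ; *ₗ-closed = λ a (u₁ , u₂) → U₁.*ₗ-closed a u₁ , U₂.*ₗ-closed a u₂
      }
      where
      module U₁ = Subspace U₁
      module U₂ = Subspace U₂

    -- The sum U₁ + U₂, which need not be direct.
    _⊕_ : Subspace V → Subspace V → Subspace V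
    U₁ ⊕ U₂ = record
      { ⟪_⟫       = λ x → ∃₂ λ u₁ u₂ → ⟪ U₁ ⟫ u₁ × ⟪ U₂ ⟫ u₂ × x ≈ᴹ u₁ +ᴹ u₂
      ; respects  = λ p (u₁ , u₂ , m₁ , m₂ , e) →
                      u₁ , u₂ , m₁ , m₂ , ≈ᴹ-trans (≈ᴹ-sym p) e
      ; 0-closed  = 0ᴹ , 0ᴹ , U₁.0-closed , U₂.0-closed
                  , ≈ᴹ-sym (+ᴹ-identityˡ 0ᴹ)
      ; +-closed  = λ (u₁ , u₂ , m₁ , m₂ , e) (v₁ , v₂ , n₁ , n₂ , e′) →
                      u₁ +ᴹ v₁ , u₂ +ᴹ v₂ , U₁.+-closed m₁ n₁ , U₂.+-closed m₂ n₂
                    , ≈ᴹ-trans (+ᴹ-cong e e′) (interchange u₁ u₂ v₁ v₂)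
      ; *ₗ-closed = λ a (u₁ , u₂ , m₁ , m₂ , e) →
                      a *ₗ u₁ , a *ₗ u₂ , U₁.*ₗ-closed a m₁ , U₂.*ₗ-closed a m₂
                    , ≈ᴹ-trans (*ₗ-congˡ e) (*ₗ-distribˡ a u₁ u₂)
      }
      where
      module U₁ = Subspace U₁
      module U₂ = Subspace U₂
      open CommutativeSemigroupProperties
        (CommutativeMonoid.commutativeSemigroup +ᴹ-commutativeMonoid)
        using (interchange)

    whole : Subspace V
    whole = record
      { ⟪_⟫       = λ _ → ⊤
      ; respects  = λ _ _ → tt
      ; 0-closed  = tt
      ; +-closed  = λ _ _ → tt
      ; *ₗ-closed = λ _ _ → tt
      }

  preimage : {V W : VectorSpace K} → LinearMap V W → Subspace W → Subspace V
  preimage {V} {W} f U = record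
    { ⟪_⟫       = ⟪ U ⟫ ∘ ⟦ f ⟧
    ; respects  = λ p → U.respects (f.⟦⟧-cong p)
    ; 0-closed  = U.respects (W.≈ᴹ-sym f.0ᴹ-homo) U.0-closed
    ; +-closed  = λ u v → U.respects (W.≈ᴹ-sym (f.+ᴹ-homo _ _)) (U.+-closed u v)
    ; *ₗ-closed = λ a u → U.respects (W.≈ᴹ-sym (f.*ₗ-homo a _)) (U.*ₗ-closed a u)
    }
    where
    module W = VectorSpace W
    module f = LinearMap f
    module U = Subspace U

  ⨁ˢ : ∀ {n} {M : Fin n → VectorSpace K} → (∀ i → Subspace (M i)) → Subspace (⨁ M)
  ⨁ˢ {n} U = record
    { ⟪_⟫       = λ x → ∀ i → ⟪ U i ⟫ (x i)
    ; respects  = λ p u i → U.respects i (p i) (u i)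
    ; 0-closed  = λ i → U.0-closed i
    ; +-closed  = λ u v i → U.+-closed i (u i) (v i)
    ; *ₗ-closed = λ a u i → U.*ₗ-closed i a (u i)
    }
    where module U (i : Fin n) = Subspace (U i)

  record Basis {V : VectorSpace K} (U : Subspace V) (n : ℕ) : Set ℓ where
    open VectorSpace V
    field
      vec         : Vector ∣ V ∣ n
      belongs     : ∀ i → ⟪ U ⟫ (vec i)
      spans       : ∀ {x} → ⟪ U ⟫ x →
                    ∃ λ (a : Vector 𝕂 n) → x ≈ᴹ ∑ V (λ i → a i *ₗ vec i)
      independent : ∀ (a : Vector 𝕂 n) → ∑ V (λ i → a i *ₗ vec i) ≈ᴹ 0ᴹ →
                    ∀ i → a i ≈ᴷ 0ᴷ

  FiniteDimensional : VectorSpace K → Set ℓ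
  FiniteDimensional V = ∃ (Basis (whole {V}))

-- Dimensions of arbitrary subspaces and maxima over all subspaces cannot
-- be computed, so excluded middle is an explicit argument below.

lowerEM : ExcludedMiddle (lsuc ℓ) → ExcludedMiddle ℓ
lowerEM {ℓ} em {P} = map′ lower lift (em {Lift (lsuc ℓ) P})

-- Some element satisfying P, or the default value if there is none.
choose : ∀ {a p} {A : Set a} → A → (P : Pred A p) → Dec (∃ P) → A
choose default P (yes (x , _)) = x
choose default P (no _)        = default

-- The default value 0 is only taken by subspaces without a finite basis,
-- hence by no subspace of a finite-dimensional space.
dim : {K : Field ℓ} → ExcludedMiddle (lsuc ℓ) → {V : VectorSpace K} → Subspace V → ℕ
dim em U = choose 0 (Basis U) (lowerEM em)

IsMaximum : ∀ {a} {A : Set a} → (A → ℤ) → Pred ℤ a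
IsMaximum f m = (∃ λ x → f x ≡ m) × (∀ x → f x ≤ m)

Maximal Minimal : {K : Field ℓ} {V : VectorSpace K} →
                  Pred (Subspace V) 0ℓ → Pred (Subspace V) (lsuc ℓ)
Maximal S U = S U × (∀ {U′} → S U′ → U ⊑ U′ → U ≋ U′)
Minimal S U = S U × (∀ {U′} → S U′ → U′ ⊑ U → U ≋ U′)

record Digraph : Set where
  field
    #V #E     : ℕ
    tail head : Fin #E → Fin #V

record Sheaf (K : Field ℓ) (G : Digraph) : Set (lsuc ℓ) where
  open Digraph G
  field
    atV   : Fin #V → VectorSpace K
    atE   : Fin #E → VectorSpace K
    finV  : ∀ v → FiniteDimensional (atV v)
    finE  : ∀ e → FiniteDimensional (atE e)
    resₜ  : ∀ e → LinearMap (atE e) (atV (tail e))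
    resₕ  : ∀ e → LinearMap (atE e) (atV (head e))

  totalV totalE : VectorSpace K
  totalV = ⨁ atV
  totalE = ⨁ atE

  dₕ dₜ : LinearMap totalE totalV
  dₕ = copair (λ e → ι (head e) ∘ₗ resₕ e)
  dₜ = copair (λ e → ι (tail e) ∘ₗ resₜ e)

  Γₕₜ : Subspace totalV → Subspace totalE
  Γₕₜ U = ⨁ˢ (λ e → preimage (dₕ ∘ₗ ι e) U ⊓ preimage (dₜ ∘ₗ ι e) U)

  excess : ExcludedMiddle (lsuc ℓ) → Subspace totalV → ℤ
  excess em U = dim em (Γₕₜ U) ⊖ dim em U

  -- The default value 0 is never taken: excess is bounded above by
  -- dim F(E), so the maximum exists.
  maxExcess : ExcludedMiddle (lsuc ℓ) → ℤ
  maxExcess em = choose 0ℤ (IsMaximum (excess em)) em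

  Maximizer : ExcludedMiddle (lsuc ℓ) → Pred (Subspace totalV) 0ℓ
  Maximizer em U = excess em U ≡ maxExcess em

{-# OPTIONS --safe #-}
module Submission where

-- Both summands of the excess are compared through the modular identity
-- dim (U ⊓ W) + dim (U ⊕ W) = dim U + dim W. In F(V) it is applied to
-- U₁ and U₂, in F(E) to Γₕₜ U₁ and Γₕₜ U₂, where
-- Γₕₜ U₁ ⊓ Γₕₜ U₂ = Γₕₜ (U₁ ⊓ U₂) but only Γₕₜ U₁ ⊕ Γₕₜ U₂ ⊑ Γₕₜ (U₁ ⊕ U₂).
-- For two maximizers every inequality is tight, so the last inclusion is an
-- equality of subspaces of equal finite dimension.
--
-- Dimensions are handled through chains A ⊑ A ▹ x ⊑ A ▹ x ▹ y ⊑ …, each vector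
-- lying outside the subspace before it: by Steinitz exchange the length of a
-- chain from A to B depends only on A and B, and adding W to each term of a
-- chain from U ⊓ W to U gives a chain of the same length from W to U ⊕ W.

open import Defs
open import Algebra.Bundles using (CommutativeMonoid)
import Algebra.Properties.CommutativeMonoid.Sum as Sum
import Algebra.Properties.CommutativeSemigroup as CommutativeSemigroupProperties
import Algebra.Properties.Group as GroupProperties
open import Axiom.ExcludedMiddle using (ExcludedMiddle)
open import Data.Fin.Base as Fin using (Fin)
open import Data.Integer.Base as ℤ using (ℤ; _+_; _≤_; _⊖_; 0ℤ)
import Data.Integer.Properties as ℤ
open import Data.Nat.Base as ℕ using (ℕ; zero)
import Data.Nat.Properties as ℕ
open import Data.Product using (_×_; ∃!; ∃; _,_; proj₁; proj₂; swap)
open import Data.Unit.Polymorphic.Base using (tt)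
open import Data.Vec.Functional using (Vector; _∷_; [])
open import Function.Base using (_∘_; id; case_of_)
open import Level using (suc; 0ℓ)
open import Relation.Binary.PropositionalEquality as ≡ using (_≡_)
import Relation.Binary.Reasoning.Setoid as SetoidReasoning
open import Relation.Nullary using (¬_; Dec; yes; no; contradiction)
open import Relation.Unary using (Pred)

-- Maxima of bounded integer-valued functions.

choose-satisfies : ∀ {a p} {A : Set a} (d : A) (P : Pred A p) (P? : Dec (∃ P)) →
                   ∃ P → P (choose d P P?)
choose-satisfies d P (yes (_ , p)) _ = p
choose-satisfies d P (no ¬p)       p = contradiction p ¬p

module _ {a} (em : ExcludedMiddle a) {A : Set a} (f : A → ℤ) where

  private
    -- Induction on the slack `k`: moving to a strictly larger value gains at least 1, so the same
    -- upper bound holds with one unit of slack less. With no slack left, `x` itself is optimal.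
    climb : ∀ k x → (∀ y → f y ≤ f x + ℤ.+ k) → ∃ λ z → ∀ y → f y ≤ f z
    climb zero    x f≤ = x , λ y → ℤ.≤-trans (f≤ y) (ℤ.≤-reflexive (ℤ.+-identityʳ (f x)))
    climb (ℕ.suc k) x f≤ with em {∃ λ y → f x ℤ.< f y}
    ... | no  ¬∃        = x , λ y → ℤ.≮⇒≥ λ fx<fy → ¬∃ (y , fx<fy)
    ... | yes (y , fx<fy) = climb k y λ z → ℤ.≤-trans (f≤ z) (ℤ.≤-trans
            (ℤ.≤-reflexive (≡.trans (≡.sym (ℤ.+-assoc (f x) (ℤ.+ 1) (ℤ.+ k)))
              (≡.cong (_+ ℤ.+ k) (ℤ.+-comm (f x) (ℤ.+ 1)))))
            (ℤ.+-monoˡ-≤ (ℤ.+ k) (ℤ.i<j⇒suc[i]≤j fx<fy)))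

  bounded⇒maximum : A → ∀ b → (∀ x → f x ≤ b) → ∃ λ x → ∀ y → f y ≤ f x
  bounded⇒maximum x b f≤b = climb ℤ.∣ b ℤ.- f x ∣ x λ y → ℤ.≤-trans (f≤b y)
    (ℤ.≤-reflexive (≡.sym (≡.trans
      (≡.cong (f x +_) (ℤ.0≤i⇒+∣i∣≡i (ℤ.i≤j⇒0≤j-i (f≤b x))))
      (≡.trans (ℤ.+-comm (f x) _) (≡.trans (ℤ.+-assoc b _ _)
        (≡.trans (≡.cong (b +_) (ℤ.+-inverseˡ (f x))) (ℤ.+-identityʳ b)))))))

-- Integer arithmetic of differences.

⊖-+-⊖ : ∀ a b c d → (a ⊖ b) + (c ⊖ d) ≡ (a ℕ.+ c) ⊖ (b ℕ.+ d)
⊖-+-⊖ a b c d = begin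
  (a ⊖ b) + (c ⊖ d)                               ≡⟨ ≡.cong₂ _+_ (ℤ.m-n≡m⊖n a b) (ℤ.m-n≡m⊖n c d) ⟨
  (ℤ.+ a + ℤ.- (ℤ.+ b)) + (ℤ.+ c + ℤ.- (ℤ.+ d))   ≡⟨ interchange (ℤ.+ a) (ℤ.- (ℤ.+ b)) (ℤ.+ c) (ℤ.- (ℤ.+ d)) ⟩
  (ℤ.+ a + ℤ.+ c) + (ℤ.- (ℤ.+ b) + ℤ.- (ℤ.+ d))   ≡⟨ ≡.cong (ℤ.+ (a ℕ.+ c) +_) (ℤ.neg-distrib-+ (ℤ.+ b) (ℤ.+ d)) ⟨
  ℤ.+ (a ℕ.+ c) + ℤ.- (ℤ.+ (b ℕ.+ d))             ≡⟨ ℤ.m-n≡m⊖n (a ℕ.+ c) (b ℕ.+ d) ⟩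
  (a ℕ.+ c) ⊖ (b ℕ.+ d)                           ∎
  where
  open ≡.≡-Reasoning
  open CommutativeSemigroupProperties
    (CommutativeMonoid.commutativeSemigroup ℤ.+-0-commutativeMonoid) using (interchange)

⊖-cancelʳ-≤ : ∀ {m n} k → m ⊖ k ≤ n ⊖ k → m ℕ.≤ n
⊖-cancelʳ-≤ {m} {n} k m⊖k≤n⊖k = ℕ.≮⇒≥ λ n<m →
  ℤ.<⇒≱ (ℤ.⊖-monoˡ-< k n<m) m⊖k≤n⊖k

-- If either summand fell strictly below `x`, the sum would fall strictly below `x + x`.
+-tight : ∀ {x y z} → x + x ≤ y + z → y ≤ x → z ≤ x → y ≡ x × z ≡ x
+-tight x+x≤y+z y≤x z≤x =
  ℤ.≤-antisym y≤x (ℤ.≮⇒≥ λ y<x → ℤ.<⇒≱ (ℤ.+-mono-<-≤ y<x z≤x) x+x≤y+z) ,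
  ℤ.≤-antisym z≤x (ℤ.≮⇒≥ λ z<x → ℤ.<⇒≱ (ℤ.+-mono-≤-< y≤x z<x) x+x≤y+z)

-- Linear combinations and adjoining a vector to a subspace.

module _ {ℓ} {K : Field ℓ} {V : VectorSpace K} where
  open Field K using (inverse; 1≉0)
    renaming (Carrier to 𝕂; _≈_ to _≈ᴷ_; 0# to 0ᴷ; 1# to 1ᴷ; -_ to -ᴷ_)
  private module 𝔽 = Field K
  open VectorSpace V
  open SetoidReasoning ≈ᴹ-setoid
  open CommutativeSemigroupProperties
    (CommutativeMonoid.commutativeSemigroup +ᴹ-commutativeMonoid)
    using (x∙yz≈xz∙y; interchange)

  *ₗ-cancel-neg : ∀ c x → (c *ₗ x) +ᴹ ((-ᴷ c) *ₗ x) ≈ᴹ 0ᴹ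
  *ₗ-cancel-neg c x = begin
    (c *ₗ x) +ᴹ ((-ᴷ c) *ₗ x)  ≈⟨ *ₗ-distribʳ x c (-ᴷ c) ⟨
    (c 𝔽.+ -ᴷ c) *ₗ x          ≈⟨ *ₗ-congʳ (𝔽.-‿inverseʳ c) ⟩
    0ᴷ *ₗ x                    ≈⟨ *ₗ-zeroˡ x ⟩
    0ᴹ                         ∎

  *ₗ-inverse-cancel : ∀ {b c} x → b 𝔽.* c ≈ᴷ 1ᴷ → b *ₗ (c *ₗ x) ≈ᴹ x
  *ₗ-inverse-cancel {b} {c} x bc≈1 =
    ≈ᴹ-trans (≈ᴹ-sym (*ₗ-assoc b c x)) (≈ᴹ-trans (*ₗ-congʳ bc≈1) (*ₗ-identityˡ x))

  lincomb : ∀ {n} → Vector 𝕂 n → Vector ∣ V ∣ n → ∣ V ∣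
  lincomb a v = ∑ V (λ i → a i *ₗ v i)

  lincomb-zero : ∀ {n} (a : Vector 𝕂 n) (v : Vector ∣ V ∣ n) →
                 (∀ i → a i ≈ᴷ 0ᴷ) → lincomb a v ≈ᴹ 0ᴹ
  lincomb-zero {n} a v a≈0 = ≈ᴹ-trans
    (Sum.sum-cong-≋ +ᴹ-commutativeMonoid (λ i → ≈ᴹ-trans (*ₗ-congʳ (a≈0 i)) (*ₗ-zeroˡ (v i))))
    (Sum.sum-replicate-zero +ᴹ-commutativeMonoid n)

  lincomb-neg : ∀ {n} (a : Vector 𝕂 n) (v : Vector ∣ V ∣ n) →
                lincomb a v +ᴹ lincomb (-ᴷ_ ∘ a) v ≈ᴹ 0ᴹ
  lincomb-neg {n} a v = begin
    lincomb a v +ᴹ lincomb (-ᴷ_ ∘ a) v                ≈⟨ Sum.∑-distrib-+ +ᴹ-commutativeMonoid (λ i → a i *ₗ v i) _ ⟨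
    ∑ V (λ i → (a i *ₗ v i) +ᴹ ((-ᴷ a i) *ₗ v i))     ≈⟨ Sum.sum-cong-≋ +ᴹ-commutativeMonoid (λ i → *ₗ-cancel-neg (a i) (v i)) ⟩
    ∑ V {n} (λ _ → 0ᴹ)                                ≈⟨ Sum.sum-replicate-zero +ᴹ-commutativeMonoid n ⟩
    0ᴹ                                                ∎

  infixl 6 _▹_

  -- The sum of A and the line through x. Membership of y is phrased as
  -- y + c x ∈ A, rather than y = a + c x, so that no vector a is quantified.
  _▹_ : Subspace V → ∣ V ∣ → Subspace V
  A ▹ x = record
    { ⟪_⟫       = λ y → ∃ λ c → ⟪ A ⟫ (y +ᴹ (c *ₗ x))
    ; respects  = λ p (c , m) → c , A.respects (+ᴹ-congʳ p) m
    ; 0-closed  = 0ᴷ , A.respects (≈ᴹ-sym (≈ᴹ-trans (+ᴹ-identityˡ _) (*ₗ-zeroˡ x))) A.0-closed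
    ; +-closed  = λ (c , m) (d , n) → c 𝔽.+ d , A.respects
        (≈ᴹ-trans (interchange _ _ _ _) (+ᴹ-congˡ (≈ᴹ-sym (*ₗ-distribʳ x c d)))) (A.+-closed m n)
    ; *ₗ-closed = λ b (c , m) → b 𝔽.* c , A.respects
        (≈ᴹ-trans (*ₗ-distribˡ b _ _) (+ᴹ-congˡ (≈ᴹ-sym (*ₗ-assoc b c x)))) (A.*ₗ-closed b m)
    }
    where module A = Subspace A

  module _ (A : Subspace V) where
    private module A = Subspace A

    +-cancelʳ-∈ : ∀ {x y} c → ⟪ A ⟫ x → ⟪ A ⟫ (y +ᴹ (c *ₗ x)) → ⟪ A ⟫ y
    +-cancelʳ-∈ {x} {y} c x∈A m = A.respects (begin
      (y +ᴹ (c *ₗ x)) +ᴹ ((-ᴷ c) *ₗ x)  ≈⟨ +ᴹ-assoc _ _ _ ⟩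
      y +ᴹ ((c *ₗ x) +ᴹ ((-ᴷ c) *ₗ x))  ≈⟨ +ᴹ-congˡ (*ₗ-cancel-neg c x) ⟩
      y +ᴹ 0ᴹ                           ≈⟨ +ᴹ-identityʳ y ⟩
      y                                 ∎) (A.+-closed m (A.*ₗ-closed (-ᴷ c) x∈A))

    scaled-∈ : ∀ {c x} → ¬ c ≈ᴷ 0ᴷ → ⟪ A ⟫ (c *ₗ x) → ⟪ A ⟫ x
    scaled-∈ {c} c≉0 m with inverse c c≉0
    ... | b , cb≈1 = A.respects (*ₗ-inverse-cancel _ (𝔽.trans (𝔽.*-comm b c) cb≈1))
                       (A.*ₗ-closed b m)

    ▹-⊒ : ∀ x → A ⊑ A ▹ x
    ▹-⊒ x {y} m = 0ᴷ , A.respects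
      (≈ᴹ-sym (≈ᴹ-trans (+ᴹ-congˡ (*ₗ-zeroˡ x)) (+ᴹ-identityʳ y))) m

    ∈-▹ : ∀ x → ⟪ A ▹ x ⟫ x
    -- Membership in `A ▹ x` adds a multiple of `x`, hence the coefficient -1.
    ∈-▹ x = -ᴷ 1ᴷ , A.respects
      (≈ᴹ-sym (≈ᴹ-trans (+ᴹ-congʳ (≈ᴹ-sym (*ₗ-identityˡ x))) (*ₗ-cancel-neg 1ᴷ x))) A.0-closed

  -- Exchange of one vector: in `y + c x ∈ A` the coefficient `c` is nonzero, since otherwise
  -- `y ∈ A`. Thus `c x` lies in `A ▹ y`, and so does `x` after division by `c`.
  ▹-swap : ∀ (A : Subspace V) {x y} → ⟪ A ▹ x ⟫ y → ¬ ⟪ A ⟫ y → ⟪ A ▹ y ⟫ x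
  ▹-swap A {x} {y} (c , m) y∉A = scaled-∈ (A ▹ y) c≉0
    (1ᴷ , A.respects (≈ᴹ-trans (+ᴹ-comm y _) (+ᴹ-congˡ (≈ᴹ-sym (*ₗ-identityˡ y)))) m)
    where
    module A = Subspace A
    c≉0 : ¬ c ≈ᴷ 0ᴷ
    c≉0 c≈0 = y∉A (A.respects
      (≈ᴹ-trans (+ᴹ-congˡ (≈ᴹ-trans (*ₗ-congʳ c≈0) (*ₗ-zeroˡ x))) (+ᴹ-identityʳ y)) m)

  ▹-mono : ∀ (A B : Subspace V) {x} → A ⊑ B → A ▹ x ⊑ B ▹ x
  ▹-mono A B A⊑B (c , m) = c , A⊑B m

  ▹-least : ∀ (A B : Subspace V) {x} → A ⊑ B → ⟪ B ⟫ x → A ▹ x ⊑ B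
  ▹-least A B A⊑B x∈B (c , m) = +-cancelʳ-∈ B c x∈B (A⊑B m)

  ▹-comm : ∀ (A : Subspace V) x y → A ▹ x ▹ y ⊑ A ▹ y ▹ x
  ▹-comm A x y = ▹-least (A ▹ x) (A ▹ y ▹ x) (▹-mono A (A ▹ y) (▹-⊒ A y))
                   (▹-⊒ (A ▹ y) x (∈-▹ A y))

  ⊕-⊒ˡ : ∀ (A B : Subspace V) → A ⊑ A ⊕ B
  ⊕-⊒ˡ A B {x} x∈A = x , 0ᴹ , x∈A , Subspace.0-closed B , ≈ᴹ-sym (+ᴹ-identityʳ x)

  ⊕-⊒ʳ : ∀ (A B : Subspace V) → B ⊑ A ⊕ B
  ⊕-⊒ʳ A B {x} x∈B = 0ᴹ , x , Subspace.0-closed A , x∈B , ≈ᴹ-sym (+ᴹ-identityˡ x)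

  ⊕-least : ∀ (A B C : Subspace V) → A ⊑ C → B ⊑ C → A ⊕ B ⊑ C
  ⊕-least A B C A⊑C B⊑C (a , b , a∈A , b∈B , x≈a+b) =
    Subspace.respects C (≈ᴹ-sym x≈a+b) (Subspace.+-closed C (A⊑C a∈A) (B⊑C b∈B))

  𝟎 : Subspace V
  𝟎 = record
    { ⟪_⟫       = _≈ᴹ 0ᴹ
    ; respects  = λ p q → ≈ᴹ-trans (≈ᴹ-sym p) q
    ; 0-closed  = ≈ᴹ-refl
    ; +-closed  = λ p q → ≈ᴹ-trans (+ᴹ-cong p q) (+ᴹ-identityˡ 0ᴹ)
    ; *ₗ-closed = λ a p → ≈ᴹ-trans (*ₗ-congˡ p) (*ₗ-zeroʳ a)
    }

  𝟎-⊑ : (A : Subspace V) → 𝟎 ⊑ A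
  𝟎-⊑ A x≈0 = Subspace.respects A (≈ᴹ-sym x≈0) (Subspace.0-closed A)

  -- Chains of subspaces and relative bases.

  -- A chain of length n witnesses dim (B / A) = n.
  data Chain (A B : Subspace V) : ℕ → Set (suc ℓ) where
    done : A ≋ B → Chain A B zero
    step : ∀ {n} x → ¬ ⟪ A ⟫ x → Chain (A ▹ x) B n → Chain A B (ℕ.suc n)

  chain⇒⊑ : ∀ {A B n} → Chain A B n → A ⊑ B
  chain⇒⊑ (done A≋B)         = proj₁ A≋B
  chain⇒⊑ {A} (step x x∉A c) = chain⇒⊑ c ∘ ▹-⊒ A x

  chain-head-∈ : ∀ A {B x n} → Chain (A ▹ x) B n → ⟪ B ⟫ x
  chain-head-∈ A {x = x} c = chain⇒⊑ c (∈-▹ A x)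

  chain-respˡ : ∀ {A A′ B n} → A ≋ A′ → Chain A B n → Chain A′ B n
  chain-respˡ A≋A′ (done (A⊑B , B⊑A)) = done (A⊑B ∘ proj₂ A≋A′ , proj₁ A≋A′ ∘ B⊑A)
  chain-respˡ {A} {A′} (A⊑ , ⊑A) (step x x∉A c) = step x (x∉A ∘ ⊑A)
    (chain-respˡ (▹-mono A A′ A⊑ , ▹-mono A′ A ⊑A) c)

  chain-respʳ : ∀ {A B B′ n} → B ≋ B′ → Chain A B n → Chain A B′ n
  chain-respʳ (p , q) (done (A⊑B , B⊑A)) = done (p ∘ A⊑B , B⊑A ∘ q)
  chain-respʳ B≋B′ (step x x∉A c) = step x x∉A (chain-respʳ B≋B′ c)

  chain-++ : ∀ {A B C m n} → Chain A B m → Chain B C n → Chain A C (m ℕ.+ n)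
  chain-++ (done A≋B) d = chain-respˡ (swap A≋B) d
  chain-++ (step x x∉A c)     d = step x x∉A (chain-++ c d)

  -- The same vectors serve in both chains. If `x = a + w` with `a ∈ A` and `w ∈ W`, then
  -- `w = x - a` lies in `U`, hence in `U ⊓ W ⊑ A`, which puts `x` in `A`. Assuming only
  -- `U ⊓ W ⊑ A`, instead of equality, lets the induction pass to `A ▹ x`.
  modular : ∀ {A U W n} → U ⊓ W ⊑ A → Chain A U n → Chain (A ⊕ W) (U ⊕ W) n
  modular {A} {U} {W} U⊓W⊑A (done (A⊑U , U⊑A)) = done
    ( ⊕-least A W (U ⊕ W) (⊕-⊒ˡ U W ∘ A⊑U) (⊕-⊒ʳ U W)
    , ⊕-least U W (A ⊕ W) (⊕-⊒ˡ A W ∘ U⊑A) (⊕-⊒ʳ A W) )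
  modular {A} {U} {W} U⊓W⊑A (step x x∉A c) = step x x∉A⊕W
    -- The recursive chain starts at `(A ▹ x) ⊕ W`, which is the same subspace as `(A ⊕ W) ▹ x`.
    (chain-respˡ
      ( ⊕-least (A ▹ x) W ((A ⊕ W) ▹ x) (▹-mono A (A ⊕ W) (⊕-⊒ˡ A W))
          (▹-⊒ (A ⊕ W) x ∘ ⊕-⊒ʳ A W)
      , ▹-least (A ⊕ W) ((A ▹ x) ⊕ W)
          (⊕-least A W ((A ▹ x) ⊕ W) (⊕-⊒ˡ (A ▹ x) W ∘ ▹-⊒ A x) (⊕-⊒ʳ (A ▹ x) W))
          (⊕-⊒ˡ (A ▹ x) W (∈-▹ A x)) )
      (modular {A ▹ x} {U} {W} (λ m → ▹-⊒ A x (U⊓W⊑A m)) c))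
    where
    module A = Subspace A
    module U = Subspace U
    module W = Subspace W
    x∉A⊕W : ¬ ⟪ A ⊕ W ⟫ x
    x∉A⊕W (a , w , a∈A , w∈W , x≈a+w) = x∉A (A.respects (≈ᴹ-sym x≈a+w)
      (A.+-closed a∈A (U⊓W⊑A (w∈U , w∈W))))
      where
      w∈U : ⟪ U ⟫ w
      w∈U = +-cancelʳ-∈ U 1ᴷ (chain⇒⊑ {A} (step x x∉A c) a∈A) (U.respects
        (≈ᴹ-trans x≈a+w (≈ᴹ-trans (+ᴹ-comm a w) (+ᴹ-congˡ (≈ᴹ-sym (*ₗ-identityˡ a)))))
        (chain-head-∈ A c))

  -- A basis of `B / A`, stated without quotient spaces. As in `▹`, `spans` adds the combination
  -- instead of subtracting it, so moving a basis vector into `A` only regroups a sum.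
  record RelativeBasis (A B : Subspace V) (n : ℕ) : Set ℓ where
    field
      vec         : Vector ∣ V ∣ n
      contains    : A ⊑ B
      belongs     : ∀ i → ⟪ B ⟫ (vec i)
      spans       : ∀ {x} → ⟪ B ⟫ x → ∃ λ a → ⟪ A ⟫ (x +ᴹ lincomb a vec)
      independent : ∀ a → ⟪ A ⟫ (lincomb a vec) → ∀ i → a i ≈ᴷ 0ᴷ

  -- The first basis vector is adjoined to `A`; the others form a basis of `B` modulo the enlarged
  -- subspace.
  relativeBasis⇒chain : ∀ {n A B} → RelativeBasis A B n → Chain A B n
  relativeBasis⇒chain {zero} {A} {B} β = done
    (contains , λ x∈B → A.respects (+ᴹ-identityʳ _) (proj₂ (spans x∈B)))
    where
    open RelativeBasis β
    module A = Subspace A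
  relativeBasis⇒chain {ℕ.suc n} {A} {B} β = step (vec Fin.zero) x∉A (relativeBasis⇒chain record
    { vec         = vec ∘ Fin.suc
    ; contains    = ▹-least A B contains (belongs Fin.zero)
    ; belongs     = belongs ∘ Fin.suc
    ; spans       = λ y∈B → case spans y∈B of λ (a , m) →
        a ∘ Fin.suc , a Fin.zero , A.respects (x∙yz≈xz∙y _ _ _) m
    ; independent = λ a (c , m) i →
        independent (c ∷ a) (A.respects (+ᴹ-comm _ _) m) (Fin.suc i)
    })
    where
    open RelativeBasis β
    module A = Subspace A
    x∉A : ¬ ⟪ A ⟫ (vec Fin.zero)
    x∉A x∈A = 1≉0 (independent (1ᴷ ∷ λ _ → 0ᴷ)
      (A.respects (≈ᴹ-sym (≈ᴹ-trans
        (+ᴹ-cong (*ₗ-identityˡ _) (lincomb-zero (λ _ → 0ᴷ) (vec ∘ Fin.suc) (λ _ → 𝔽.refl)))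
        (+ᴹ-identityʳ _))) x∈A)
      Fin.zero)

  basis⇒chain : ∀ {U n} → Basis U n → Chain 𝟎 U n
  basis⇒chain {U} β = relativeBasis⇒chain record
    { vec         = vec
    ; contains    = 𝟎-⊑ U
    ; belongs     = belongs
    ; spans       = λ x∈U → case spans x∈U of λ (a , x≈) →
        -- The coefficients change sign because `RelativeBasis` asks for `x` plus a combination to
        -- vanish.
        -ᴷ_ ∘ a , ≈ᴹ-trans (+ᴹ-congʳ x≈) (lincomb-neg a vec)
    ; independent = independent
    }
    where open Basis β

-- Steinitz exchange and dimension as the length of a chain.

module LinearAlgebra {ℓ} (em : ExcludedMiddle (suc ℓ)) {K : Field ℓ} where
  open Field K using ()
    renaming (_≈_ to _≈ᴷ_; 0# to 0ᴷ; -_ to -ᴷ_)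

  module _ {V : VectorSpace K} where
    open VectorSpace V
    open CommutativeSemigroupProperties
      (CommutativeMonoid.commutativeSemigroup +ᴹ-commutativeMonoid)
      using (x∙yz≈xz∙y)
    open GroupProperties +ᴹ-group using (inverseˡ-unique)

    chain⇒relativeBasis : ∀ {A B : Subspace V} {n} → Chain A B n → RelativeBasis A B n
    chain⇒relativeBasis {A} (done (A⊑B , B⊑A)) = record
      { vec         = []
      ; contains    = A⊑B
      ; belongs     = λ ()
      ; spans       = λ x∈B → [] , Subspace.respects A (≈ᴹ-sym (+ᴹ-identityʳ _)) (B⊑A x∈B)
      ; independent = λ _ _ ()
      }
    chain⇒relativeBasis {A} {B} {ℕ.suc n} (step x x∉A c) = record
      { vec         = x ∷ vec
      ; contains    = contains ∘ ▹-⊒ A x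
      ; belongs     = λ { Fin.zero → chain-head-∈ A c ; (Fin.suc i) → belongs i }
      ; spans       = λ y∈B → case spans y∈B of λ (a , c , m) →
          c ∷ a , A.respects (≈ᴹ-sym (x∙yz≈xz∙y _ _ _)) m
      ; independent = independent′
      }
      where
      open RelativeBasis (chain⇒relativeBasis c)
      module A = Subspace A
      tail≈0 : ∀ a → ⟪ A ⟫ (lincomb {V = V} a (x ∷ vec)) → ∀ i → a (Fin.suc i) ≈ᴷ 0ᴷ
      tail≈0 a m = independent (a ∘ Fin.suc) (a Fin.zero , A.respects (+ᴹ-comm _ _) m)

      independent′ : ∀ a → ⟪ A ⟫ (lincomb {V = V} a (x ∷ vec)) → ∀ i → a i ≈ᴷ 0ᴷ
      independent′ a m (Fin.suc i) = tail≈0 a m i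
      -- The other coefficients vanish, so `A` contains the multiple of `x` by the first one; were
      -- that scalar nonzero, `x` would lie in `A`.
      independent′ a m Fin.zero with lowerEM em {a Fin.zero ≈ᴷ 0ᴷ}
      ... | yes a₀≈0 = a₀≈0
      ... | no  a₀≉0 = contradiction (scaled-∈ A a₀≉0 (A.respects
              (≈ᴹ-trans (+ᴹ-congˡ (lincomb-zero {V = V} (a ∘ Fin.suc) vec (tail≈0 a m)))
                (+ᴹ-identityʳ _)) m)) x∉A

    chain⇒basis : ∀ {U : Subspace V} {n} → Chain 𝟎 U n → Basis U n
    chain⇒basis c = record
      { vec         = vec
      ; belongs     = belongs
      ; spans       = λ {x} x∈U → case spans x∈U of λ (a , m) → -ᴷ_ ∘ a ,
          ≈ᴹ-trans (inverseˡ-unique x (lincomb {V = V} a vec) m)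
            (≈ᴹ-sym (inverseˡ-unique (lincomb {V = V} (-ᴷ_ ∘ a) vec) (lincomb {V = V} a vec)
              (≈ᴹ-trans (+ᴹ-comm _ _) (lincomb-neg {V = V} a vec))))
      ; independent = independent
      }
      where open RelativeBasis (chain⇒relativeBasis c)

    -- Steinitz exchange. If `x ∈ A ▹ y`, then `A ▹ x` and `A ▹ y` agree and the tail of the chain
    -- can be kept. Otherwise `x` is exchanged into the tail, and the order of `x` and `y` is then
    -- reversed.
    exchange : ∀ {A B : Subspace V} {n x} → Chain A B n → ⟪ B ⟫ x → ¬ ⟪ A ⟫ x →
               ∃ λ k → n ≡ ℕ.suc k × Chain (A ▹ x) B k
    exchange (done (_ , B⊑A)) x∈B x∉A = contradiction (B⊑A x∈B) x∉A
    exchange {A} {B} {x = x} (step {n} y y∉A c) x∈B x∉A with lowerEM em {⟪ A ▹ y ⟫ x}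
    ... | yes x∈A▹y = n , ≡.refl , chain-respˡ
            ( ▹-least A (A ▹ x) (▹-⊒ A x) (▹-swap A x∈A▹y x∉A)
            , ▹-least A (A ▹ y) (▹-⊒ A y) x∈A▹y ) c
    ... | no x∉A▹y with exchange c x∈B x∉A▹y
    ...   | k , ≡.refl , d = ℕ.suc k , ≡.refl , step y
              (λ y∈A▹x → x∉A▹y (▹-swap A y∈A▹x y∉A))
              (chain-respˡ (▹-comm A y x , ▹-comm A x y) d)

    -- Each vector of the chain to `B` is exchanged into the chain to `C`, shortening both by one.
    chain-mono : ∀ {A B C : Subspace V} {m n} → Chain A B m → Chain A C n → B ⊑ C → m ℕ.≤ n
    chain-mono (done _)       d B⊑C = ℕ.z≤n
    chain-mono {A} (step x x∉A c) d B⊑C with exchange d (B⊑C (chain-head-∈ A c)) x∉A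
    ... | k , ≡.refl , d′ = ℕ.s≤s (chain-mono c d′ B⊑C)

    chain-unique : ∀ {A B : Subspace V} {m n} → Chain A B m → Chain A B n → m ≡ n
    chain-unique c d = ℕ.≤-antisym (chain-mono c d id) (chain-mono d c id)

    -- Vectors of `B` outside `A` are exchanged to the front until none is left; what remains is a
    -- chain from `B` to `C`. The recursion is on `n`, which every exchange lowers.
    chain-split : ∀ {n} {A B C : Subspace V} → Chain A C n → A ⊑ B → B ⊑ C →
                  ∃ (Chain A B) × ∃ (Chain B C)
    chain-split {n} {A} {B} {C} c A⊑B B⊑C with lowerEM em {∃ λ x → ⟪ B ⟫ x × ¬ ⟪ A ⟫ x}
    ... | no ¬∃ = (zero , done (A⊑B , B⊑A)) , (n , chain-respˡ (A⊑B , B⊑A) c)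
      where
      B⊑A : B ⊑ A
      B⊑A {x} x∈B with lowerEM em {⟪ A ⟫ x}
      ... | yes x∈A = x∈A
      ... | no  x∉A = contradiction (x , x∈B , x∉A) ¬∃
    ... | yes (x , x∈B , x∉A) with exchange c (B⊑C x∈B) x∉A
    ...   | k , ≡.refl , d with chain-split d (▹-least A B A⊑B x∈B) B⊑C
    ...     | (m , e) , e′ = (ℕ.suc m , step x x∉A e) , e′

    -- The chain yields a basis, so `dim` does not take its default value. The basis it picks may be
    -- another one, but it gives a chain of the same length.
    chain⇒dim : ∀ {U : Subspace V} {n} → Chain 𝟎 U n → dim em U ≡ n
    chain⇒dim {U} c = chain-unique
      (basis⇒chain (choose-satisfies 0 (Basis U) (lowerEM em) (_ , chain⇒basis c))) c

  -- Finite dimension of direct sums.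

  -- A step from `A` to `A ▹ x` pulls back to one step if some `v ∈ C` has its image in `A ▹ x` but
  -- outside `A`, and to none otherwise. The subspace `C` allows pulling back within a kernel.
  chain-preimage : ∀ {V W : VectorSpace K} (f : LinearMap V W) (C : Subspace V)
                   {A B : Subspace W} {n} → Chain A B n →
                   ∃ (Chain (C ⊓ preimage f A) (C ⊓ preimage f B))
  chain-preimage f C (done (A⊑B , B⊑A)) =
    zero , done ((λ (m , n) → m , A⊑B n) , (λ (m , n) → m , B⊑A n))
  chain-preimage {V} {W} f C {A} {B} (step x x∉A c)
    with chain-preimage f C c
       | lowerEM em {∃ λ v → ⟪ C ⟫ v × ⟪ A ▹ x ⟫ (⟦ f ⟧ v) × ¬ ⟪ A ⟫ (⟦ f ⟧ v)}
  ... | m , d | yes (v , v∈C , fv∈A▹x , fv∉A) = ℕ.suc m , step v (fv∉A ∘ proj₂)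
          (chain-respˡ (from , ▹-least (C ⊓ f⁻¹ A) (C ⊓ f⁻¹ (A ▹ x))
            (λ (w∈C , fw∈A) → w∈C , ▹-⊒ A x fw∈A) (v∈C , fv∈A▹x)) d)
    where
    module V = VectorSpace V
    module W = VectorSpace W
    module f = LinearMap f
    f⁻¹ = preimage f
    from : C ⊓ f⁻¹ (A ▹ x) ⊑ (C ⊓ f⁻¹ A) ▹ v
    -- By exchange `A ▹ x ⊑ A ▹ f v`, so `f w + b f v ∈ A` for some `b`, and this `b` also serves
    -- for `w` and `v`.
    from (w∈C , fw∈A▹x) with ▹-least A (A ▹ ⟦ f ⟧ v) (▹-⊒ A (⟦ f ⟧ v)) (▹-swap A fv∈A▹x fv∉A) fw∈A▹x
    ... | b , n = b , Subspace.+-closed C w∈C (Subspace.*ₗ-closed C b v∈C) ,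
          Subspace.respects A (W.≈ᴹ-sym (W.≈ᴹ-trans (f.+ᴹ-homo _ _) (W.+ᴹ-congˡ (f.*ₗ-homo b v)))) n
  ... | m , d | no ¬∃ = m , chain-respˡ
          (from , λ (w∈C , fw∈A) → w∈C , ▹-⊒ A x fw∈A) d
    where
    from : C ⊓ preimage f (A ▹ x) ⊑ C ⊓ preimage f A
    from {w} (w∈C , fw∈A▹x) with lowerEM em {⟪ A ⟫ (⟦ f ⟧ w)}
    ... | yes fw∈A = w∈C , fw∈A
    ... | no  fw∉A = contradiction (w , w∈C , fw∈A▹x , fw∉A) ¬∃

  Finite : VectorSpace K → Set (suc ℓ)
  Finite V = ∃ (Chain (𝟎 {V = V}) whole)

  module _ {n} (M : Fin (ℕ.suc n) → VectorSpace K) where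
    private module M i = VectorSpace (M i)

    headₗ : LinearMap (⨁ M) (M Fin.zero)
    headₗ = linearMap {V = ⨁ M} (λ x → x Fin.zero) (λ p → p Fin.zero)
      (λ _ _ → M.≈ᴹ-refl _) (λ _ _ → M.≈ᴹ-refl _)

    tailₗ : LinearMap (⨁ M) (⨁ (M ∘ Fin.suc))
    tailₗ = linearMap {V = ⨁ M} {W = ⨁ (M ∘ Fin.suc)} (λ x i → x (Fin.suc i))
      (λ p i → p (Fin.suc i)) (λ _ _ _ → M.≈ᴹ-refl _) (λ _ _ _ → M.≈ᴹ-refl _)

  -- The chain passes through the kernel of `tailₗ`. Below it, a chain of the first summand is
  -- pulled back along `headₗ` within that kernel; above it, a chain of the remaining summands is
  -- pulled back along `tailₗ`.
  ⨁-finite : ∀ {n} (M : Fin n → VectorSpace K) → (∀ i → Finite (M i)) → Finite (⨁ M)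
  ⨁-finite {zero}    M M-fin = zero , done ((λ _ → tt) , λ _ ())
  ⨁-finite {ℕ.suc n} M M-fin
    with chain-preimage (headₗ M) (preimage (tailₗ M) 𝟎) (proj₂ (M-fin Fin.zero))
       | chain-preimage (tailₗ M) whole (proj₂ (⨁-finite (M ∘ Fin.suc) (M-fin ∘ Fin.suc)))
  ... | k , c | l , d = k ℕ.+ l , chain-++
    (chain-respˡ ( (λ (t≈0 , h≈0) → λ { Fin.zero → h≈0 ; (Fin.suc i) → t≈0 i })
                 , λ x≈0 → x≈0 ∘ Fin.suc , x≈0 Fin.zero )
      (chain-respʳ ((λ (t≈0 , _) → tt , t≈0) , λ (_ , t≈0) → t≈0 , tt) c))
    (chain-respʳ ((λ _ → tt) , λ _ → tt , tt) d)

  -- Dimension in a finite-dimensional space.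

  module _ {V : VectorSpace K} (V-fin : Finite V) where

    -- A chain from `𝟎` to `whole` is cut at `U`, and its upper part at `W`.
    ⊑-chain : ∀ {U W : Subspace V} → U ⊑ W → ∃ (Chain U W)
    ⊑-chain {U} {W} U⊑W = proj₁ (chain-split
      (proj₂ (proj₂ (chain-split (proj₂ V-fin) (𝟎-⊑ U) (λ _ → tt)))) U⊑W (λ _ → tt))

    dim-chain : ∀ (U : Subspace V) → Chain 𝟎 U (dim em U)
    dim-chain U with ⊑-chain (𝟎-⊑ U)
    ... | n , c = ≡.subst (Chain 𝟎 U) (≡.sym (chain⇒dim c)) c

    dim-+ : ∀ {U W : Subspace V} {n} → Chain U W n → dim em W ≡ dim em U ℕ.+ n
    dim-+ {U} c = chain⇒dim (chain-++ (dim-chain U) c)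

    dim-mono : ∀ {U W : Subspace V} → U ⊑ W → dim em U ℕ.≤ dim em W
    dim-mono {U} {W} = chain-mono (dim-chain U) (dim-chain W)

    dim-≤⇒⊒ : ∀ {U W : Subspace V} → U ⊑ W → dim em W ℕ.≤ dim em U → W ⊑ U
    dim-≤⇒⊒ {U} {W} U⊑W W≤U with ⊑-chain U⊑W
    ... | zero    , done (_ , W⊑U) = W⊑U
    ... | ℕ.suc n , c = contradiction (≡.subst (ℕ._≤ dim em U) (dim-+ c) W≤U) (ℕ.m+1+n≰m (dim em U))

    dim-⊓-⊕ : ∀ (U W : Subspace V) →
              dim em U ℕ.+ dim em W ≡ dim em (U ⊓ W) ℕ.+ dim em (U ⊕ W)
    dim-⊓-⊕ U W with ⊑-chain {U ⊓ W} {U} proj₁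
    ... | n , c = begin
      dim em U ℕ.+ dim em W               ≡⟨ ≡.cong (ℕ._+ dim em W) (dim-+ c) ⟩
      dim em (U ⊓ W) ℕ.+ n ℕ.+ dim em W   ≡⟨ ℕ.+-assoc (dim em (U ⊓ W)) n (dim em W) ⟩
      dim em (U ⊓ W) ℕ.+ (n ℕ.+ dim em W) ≡⟨ ≡.cong (dim em (U ⊓ W) ℕ.+_) (ℕ.+-comm n (dim em W)) ⟩
      dim em (U ⊓ W) ℕ.+ (dim em W ℕ.+ n) ≡⟨ ≡.cong (dim em (U ⊓ W) ℕ.+_) (dim-+ W⟶U⊕W) ⟨
      dim em (U ⊓ W) ℕ.+ dim em (U ⊕ W)   ∎
      where
      open ≡.≡-Reasoning
      W⟶U⊕W : Chain W (U ⊕ W) n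
      -- `modular` gives a chain starting at `(U ⊓ W) ⊕ W`, which is `W`.
      W⟶U⊕W = chain-respˡ (⊕-least (U ⊓ W) W W proj₂ id , ⊕-⊒ʳ (U ⊓ W) W)
        (modular {A = U ⊓ W} {U} {W} id c)

    -- Extremal elements of families closed under sum or intersection.

    module _ {S : Pred (Subspace V) 0ℓ} where

      -- A member of greatest dimension is maximal. Its sum with any other maximal member is again
      -- in `S` and contains both, so both equal the sum.
      ∃!-maximal : ∃ S → (∀ U W → S U → S W → S (U ⊕ W)) → ∃! _≋_ (Maximal S)
      ∃!-maximal s ⊕-closed
        with bounded⇒maximum em {A = ∃ S} (λ (U , _) → ℤ.+ dim em U) s (ℤ.+ dim em (whole {V = V}))
               (λ (U , _) → ℤ.+≤+ (dim-mono {U} {whole} (λ _ → tt)))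
      ... | (U , m) , U-max = U , (m , maximal) , unique
        where
        maximal : ∀ {U′} → S U′ → U ⊑ U′ → U ≋ U′
        maximal {U′} m′ U⊑U′ = U⊑U′ , dim-≤⇒⊒ {U} {U′} U⊑U′ (ℤ.drop‿+≤+ (U-max (U′ , m′)))

        unique : ∀ {W} → Maximal S W → U ≋ W
        unique {W} (mW , W-max) =
          proj₂ (W-max {U ⊕ W} m⊕ (⊕-⊒ʳ U W)) ∘ ⊕-⊒ˡ U W ,
          proj₂ (maximal {U ⊕ W} m⊕ (⊕-⊒ˡ U W)) ∘ ⊕-⊒ʳ U W
          where m⊕ = ⊕-closed U W m mW

      ∃!-minimal : ∃ S → (∀ U W → S U → S W → S (U ⊓ W)) → ∃! _≋_ (Minimal S)
      ∃!-minimal s ⊓-closed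
        -- The least dimension is found as the maximum of its negative, which 0 bounds.
        with bounded⇒maximum em {A = ∃ S} (λ (U , _) → ℤ.- (ℤ.+ dim em U)) s 0ℤ
               (λ (U , _) → ℤ.neg-mono-≤ (ℤ.+≤+ ℕ.z≤n))
      ... | (U , m) , U-min = U , (m , minimal) , unique
        where
        minimal : ∀ {U′} → S U′ → U′ ⊑ U → U ≋ U′
        minimal {U′} m′ U′⊑U =
          dim-≤⇒⊒ {U′} {U} U′⊑U (ℤ.drop‿+≤+ (ℤ.neg-cancel-≤ (U-min (U′ , m′)))) , U′⊑U

        unique : ∀ {W} → Minimal S W → U ≋ W
        unique {W} (mW , W-min) =
          proj₂ ∘ proj₁ (minimal {U ⊓ W} m⊓ proj₁) ,
          proj₁ ∘ proj₁ (W-min {U ⊓ W} m⊓ proj₂)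
          where m⊓ = ⊓-closed U W m mW

-- Excess of a sheaf and its maximizers.

module _ {ℓ} (em : ExcludedMiddle (suc ℓ)) (K : Field ℓ) (G : Digraph) (F : Sheaf K G) where
  open Sheaf F
  open LinearAlgebra em {K}

  totalV-finite : Finite totalV
  totalV-finite = ⨁-finite atV (λ v → _ , basis⇒chain (proj₂ (finV v)))

  totalE-finite : Finite totalE
  totalE-finite = ⨁-finite atE (λ e → _ , basis⇒chain (proj₂ (finE e)))

  Γₕₜ-mono : ∀ (U W : Subspace totalV) → U ⊑ W → Γₕₜ U ⊑ Γₕₜ W
  Γₕₜ-mono U W U⊑W m e = U⊑W (proj₁ (m e)) , U⊑W (proj₂ (m e))

  Γₕₜ-⊓ : ∀ U W → Γₕₜ U ⊓ Γₕₜ W ⊑ Γₕₜ (U ⊓ W)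
  Γₕₜ-⊓ U W (m , n) e = (proj₁ (m e) , proj₁ (n e)) , (proj₂ (m e) , proj₂ (n e))

  Γₕₜ-⊕ : ∀ U W → Γₕₜ U ⊕ Γₕₜ W ⊑ Γₕₜ (U ⊕ W)
  Γₕₜ-⊕ U W = ⊕-least (Γₕₜ U) (Γₕₜ W) (Γₕₜ (U ⊕ W))
    (Γₕₜ-mono U (U ⊕ W) (⊕-⊒ˡ U W)) (Γₕₜ-mono W (U ⊕ W) (⊕-⊒ʳ U W))

  -- The modular identity in both total spaces gives this sum the same subtrahend as in
  -- `excess-⊓-⊕`, so only dimensions in `totalE` remain to be compared.
  excess-sum : ∀ U₁ U₂ → excess em U₁ + excess em U₂ ≡
    (dim em (Γₕₜ U₁ ⊓ Γₕₜ U₂) ℕ.+ dim em (Γₕₜ U₁ ⊕ Γₕₜ U₂)) ⊖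
    (dim em (U₁ ⊓ U₂) ℕ.+ dim em (U₁ ⊕ U₂))
  excess-sum U₁ U₂ = ≡.trans
    (⊖-+-⊖ (dim em (Γₕₜ U₁)) (dim em U₁) (dim em (Γₕₜ U₂)) (dim em U₂))
    (≡.cong₂ _⊖_ (dim-⊓-⊕ totalE-finite (Γₕₜ U₁) (Γₕₜ U₂)) (dim-⊓-⊕ totalV-finite U₁ U₂))

  excess-⊓-⊕ : ∀ U₁ U₂ → excess em (U₁ ⊓ U₂) + excess em (U₁ ⊕ U₂) ≡
    (dim em (Γₕₜ (U₁ ⊓ U₂)) ℕ.+ dim em (Γₕₜ (U₁ ⊕ U₂))) ⊖
    (dim em (U₁ ⊓ U₂) ℕ.+ dim em (U₁ ⊕ U₂))
  excess-⊓-⊕ U₁ U₂ = ⊖-+-⊖ (dim em (Γₕₜ (U₁ ⊓ U₂))) (dim em (U₁ ⊓ U₂))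
                              (dim em (Γₕₜ (U₁ ⊕ U₂))) (dim em (U₁ ⊕ U₂))

  dim-Γₕₜ-⊓ : ∀ U₁ U₂ → dim em (Γₕₜ U₁ ⊓ Γₕₜ U₂) ℕ.≤ dim em (Γₕₜ (U₁ ⊓ U₂))
  dim-Γₕₜ-⊓ U₁ U₂ =
    dim-mono totalE-finite {Γₕₜ U₁ ⊓ Γₕₜ U₂} {Γₕₜ (U₁ ⊓ U₂)} (Γₕₜ-⊓ U₁ U₂)

  dim-Γₕₜ-⊕ : ∀ U₁ U₂ → dim em (Γₕₜ U₁ ⊕ Γₕₜ U₂) ℕ.≤ dim em (Γₕₜ (U₁ ⊕ U₂))
  dim-Γₕₜ-⊕ U₁ U₂ =
    dim-mono totalE-finite {Γₕₜ U₁ ⊕ Γₕₜ U₂} {Γₕₜ (U₁ ⊕ U₂)} (Γₕₜ-⊕ U₁ U₂)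

  supermodular : ∀ U₁ U₂ →
    excess em U₁ + excess em U₂ ≤ excess em (U₁ ⊓ U₂) + excess em (U₁ ⊕ U₂)
  supermodular U₁ U₂ = ≡.subst₂ _≤_ (≡.sym (excess-sum U₁ U₂)) (≡.sym (excess-⊓-⊕ U₁ U₂))
    (ℤ.⊖-monoˡ-≤ (dim em (U₁ ⊓ U₂) ℕ.+ dim em (U₁ ⊕ U₂))
      (ℕ.+-mono-≤ (dim-Γₕₜ-⊓ U₁ U₂) (dim-Γₕₜ-⊕ U₁ U₂)))

  -- The excess is at most the dimension of `Γₕₜ U`, hence at most that of `totalE`; a bounded
  -- integer function attains a maximum, so the default 0 is not taken.
  maxExcess-isMaximum : IsMaximum (excess em) (maxExcess em)
  maxExcess-isMaximum = choose-satisfies 0ℤ (IsMaximum (excess em)) em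
    (case bounded⇒maximum em (excess em) whole (ℤ.+ dim em (whole {V = totalE})) bound of
      λ (U , U-max) → excess em U , (U , ≡.refl) , U-max)
    where
    bound : ∀ U → excess em U ≤ ℤ.+ dim em (whole {V = totalE})
    bound U = ℤ.≤-trans (ℤ.m⊖n≤m (dim em (Γₕₜ U)) (dim em U))
      (ℤ.+≤+ (dim-mono totalE-finite {Γₕₜ U} {whole} (λ _ → tt)))

  module _ (U₁ U₂ : Subspace totalV) (m₁ : Maximizer em U₁) (m₂ : Maximizer em U₂) where

    -- The two excesses add up to at least twice the maximum, while neither exceeds it.
    maximizer-⊓-⊕ : Maximizer em (U₁ ⊓ U₂) × Maximizer em (U₁ ⊕ U₂)
    maximizer-⊓-⊕ = +-tight
      (≡.subst₂ (λ x y → x + y ≤ excess em (U₁ ⊓ U₂) + excess em (U₁ ⊕ U₂)) m₁ m₂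
        (supermodular U₁ U₂))
      (proj₂ maxExcess-isMaximum (U₁ ⊓ U₂)) (proj₂ maxExcess-isMaximum (U₁ ⊕ U₂))

    Γₕₜ-⊕-⊑ : Γₕₜ (U₁ ⊕ U₂) ⊑ Γₕₜ U₁ ⊕ Γₕₜ U₂
    Γₕₜ-⊕-⊑ = dim-≤⇒⊒ totalE-finite {Γₕₜ U₁ ⊕ Γₕₜ U₂} {Γₕₜ (U₁ ⊕ U₂)} (Γₕₜ-⊕ U₁ U₂)
      -- The two excess sums agree and share a subtrahend, so the sums of dimensions in `totalE`
      -- agree. Since `Γₕₜ U₁ ⊓ Γₕₜ U₂` has dimension at most that of `Γₕₜ (U₁ ⊓ U₂)`, cancelling
      -- the latter bounds the dimension of `Γₕₜ (U₁ ⊕ U₂)` by that of `Γₕₜ U₁ ⊕ Γₕₜ U₂`.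
      (ℕ.+-cancelˡ-≤ (dim em (Γₕₜ (U₁ ⊓ U₂))) _ _ (ℕ.≤-trans
        (⊖-cancelʳ-≤ (dim em (U₁ ⊓ U₂) ℕ.+ dim em (U₁ ⊕ U₂)) (ℤ.≤-reflexive (begin
          _                                         ≡⟨ excess-⊓-⊕ U₁ U₂ ⟨
          excess em (U₁ ⊓ U₂) + excess em (U₁ ⊕ U₂) ≡⟨ ≡.cong₂ _+_ (proj₁ maximizer-⊓-⊕) (proj₂ maximizer-⊓-⊕) ⟩
          maxExcess em + maxExcess em               ≡⟨ ≡.cong₂ _+_ m₁ m₂ ⟨
          excess em U₁ + excess em U₂               ≡⟨ excess-sum U₁ U₂ ⟩
          _                                         ∎)))
        (ℕ.+-monoˡ-≤ _ (dim-Γₕₜ-⊓ U₁ U₂))))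
      where open ≡.≡-Reasoning

  someMaximizer : ∃ (Maximizer em)
  someMaximizer = proj₁ maxExcess-isMaximum

theorem1 : ∀ {ℓ} (em : ExcludedMiddle (suc ℓ)) (K : Field ℓ) (G : Digraph) (F : Sheaf K G) →
    let open Sheaf F in
    (∀ U₁ U₂ → excess em U₁ + excess em U₂ ≤ excess em (U₁ ⊓ U₂) + excess em (U₁ ⊕ U₂))
    × (∀ U₁ U₂ → Maximizer em U₁ → Maximizer em U₂ →
    Maximizer em (U₁ ⊓ U₂) × Maximizer em (U₁ ⊕ U₂))
    × ∃! _≋_ (Maximal (Maximizer em))
    × ∃! _≋_ (Minimal (Maximizer em))
    × (∀ U₁ U₂ → Maximizer em U₁ → Maximizer em U₂ →
    Γₕₜ (U₁ ⊕ U₂) ≋ Γₕₜ U₁ ⊕ Γₕₜ U₂)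
theorem1 em K G F =
    supermodular em K G F
  , maximizer-⊓-⊕ em K G F
  , ∃!-maximal V-fin s (λ U₁ U₂ m₁ m₂ → proj₂ (maximizer-⊓-⊕ em K G F U₁ U₂ m₁ m₂))
  , ∃!-minimal V-fin s (λ U₁ U₂ m₁ m₂ → proj₁ (maximizer-⊓-⊕ em K G F U₁ U₂ m₁ m₂))
  , λ U₁ U₂ m₁ m₂ → Γₕₜ-⊕-⊑ em K G F U₁ U₂ m₁ m₂ , Γₕₜ-⊕ em K G F U₁ U₂
  where
  open LinearAlgebra em {K}
  V-fin = totalV-finite em K G F
  s = someMaximizer em K G F
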